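{- Consider $w\in\mathfrak{S}_n$, with the weak order on $\mathfrak{S}_n$, and let $T$ be the support of $w$. Then $[\sigma,w]_{\mathrm{wk}}$ is boolean for all $\sigma\in T$ (in particular, $\sigma\le_{\mathrm{wk}}w$ for all $\sigma\in T$) if and only if $w$ is free; i.e., if and only if the principal order ideal $\{u: u\le_{\mathrm{wk}}w\}$ is boolean.
   Context: $\mathfrak{S}_n$ is the symmetric group with Coxeter generators $\sigma_1,\dots,\sigma_{n-1}$, where $\sigma_i$ is the transposition swapping $i$ and $i+1$. A reduced decomposition of $w$ is a word of minimal length in these generators with product $w$. The support of $w$ is the set of generators appearing in reduced decompositions of $w$. (Right) weak order: $v\le_{\mathrm{wk}}w$ if some reduced decomposition of $v$ is a prefix of a reduced decomposition of $w$. $[v,w]_{\mathrm{wk}}=\{u: v\le_{\mathrm{wk}}u\le_{\mathrm{wk}}w\}$; if $v\not\le_{\mathrm{wk}}w$ there is no such interval and it is not considered boolean. A permutation is free if it is a (possibly empty) product of pairwise commuting generators (equivalently, it avoids the patterns $231$, $312$, $321$). A poset is boolean if it is isomorphic to the poset of all subsets of a finite set, ordered by inclusion. -}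

module Defs where

open import Data.Nat.Base using (ℕ; suc; pred; _≤_)
open import Data.Fin.Base using (Fin; suc; inject₁)
open import Data.Fin.Permutation using (Permutation′; _≈_; _∘ₚ_; id; transpose)
open import Data.Fin.Subset using (Subset; _⊆_)
open import Data.List.Base using (List; foldr; length)
open import Data.List.Membership.Propositional using (_∈_)
open import Data.List.Relation.Binary.Prefix.Heterogeneous using (Prefix)
open import Data.List.Relation.Unary.AllPairs using (AllPairs)
open import Data.Product.Base using (Σ; ∃; ∃-syntax; _×_; proj₁)
open import Function.Base using (_on_)
open import Level using (0ℓ)
open import Relation.Binary.Core using (Rel)
open import Relation.Binary.Morphism.Structures using (IsOrderIsomorphism)
open import Relation.Binary.PropositionalEquality.Core using (_≡_)
open import Relation.Unary using (Pred)

private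
  variable
    n : ℕ

-- Composition of functions from right to left: u · v sends i to u (v i).
-- The stdlib's _∘ₚ_ composes in the opposite order.
infixr 9 _·_

_·_ : Permutation′ n → Permutation′ n → Permutation′ n
u · v = v ∘ₚ u

-- The n - 1 Coxeter generators of the symmetric group on n letters, indexed
-- from 0: σ i swaps the letters at positions i and i + 1 of Fin n.
Gen : ℕ → Set
Gen n = Fin (pred n)

σ : Gen n → Permutation′ n
σ {suc m} i = transpose (inject₁ i) (suc i)

Word : ℕ → Set
Word n = List (Gen n)

product : Word n → Permutation′ n
product = foldr (λ i u → σ i · u) id

IsReducedDecomposition : Word n → Permutation′ n → Set
IsReducedDecomposition {n} a w =
  product a ≈ w × ((b : Word n) → product b ≈ w → length a ≤ length b)

-- Each generator is represented by its index.
Support : Permutation′ n → Pred (Gen n) 0ℓ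
Support w i = ∃[ a ] (IsReducedDecomposition a w × i ∈ a)

infix 4 _≤wk_

_≤wk_ : Rel (Permutation′ n) 0ℓ
v ≤wk w = ∃[ a ] ∃[ b ]
  (IsReducedDecomposition a v × IsReducedDecomposition b w × Prefix _≡_ a b)

-- A repeated generator is allowed here; since σ i is an involution this does
-- not enlarge the class of free permutations.
Free : Permutation′ n → Set
Free {n} w = ∃[ a ] (AllPairs (λ i j → σ {n} i · σ j ≈ σ j · σ i) a × product a ≈ w)

-- The poset on A with equality _≈₁_ and order _≤₁_ is isomorphic to the poset
-- of subsets of a k-element set, for some k.
IsBoolean : {A : Set} → Rel A 0ℓ → Rel A 0ℓ → Set
IsBoolean {A} _≈₁_ _≤₁_ =
  ∃[ k ] Σ (A → Subset k) (IsOrderIsomorphism _≈₁_ _≡_ _≤₁_ _⊆_)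

-- The subset of the weak order cut out by P, where elements are compared through
-- their underlying permutations, ignoring the proofs of P.
IsBooleanSubposet : Pred (Permutation′ n) 0ℓ → Set
IsBooleanSubposet {n} P = IsBoolean {∃ P} (_≈_ on proj₁) (_≤wk_ on proj₁)

[_,_]wk : Permutation′ n → Permutation′ n → Pred (Permutation′ n) 0ℓ
[ v , w ]wk u = v ≤wk u × u ≤wk w

IsBooleanInterval : Permutation′ n → Permutation′ n → Set
IsBooleanInterval v w = v ≤wk w × IsBooleanSubposet [ v , w ]wk

HasBooleanIdeal : Permutation′ n → Set
HasBooleanIdeal w = IsBooleanSubposet (λ u → u ≤wk w)

{-# OPTIONS --safe #-}

-- A generator i is a left descent of w exactly when w⁻¹ inverts i and i + 1, exactly when σ i ≤ w in
-- the weak order; the deletion property of words gives the exchange property of reduced words.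
--
-- A boolean poset has no interval that is a chain of three elements, since the middle element would
-- have a complement different from itself.  If i and j are adjacent and the word y i j is reduced,
-- then [ y , y i j ] is such a chain.  Hence if the ideal of w is boolean, no reduced word of w has
-- adjacent generators in consecutive positions, so its letters are distinct and commute.  If the
-- intervals [ σ i , w ] are boolean and adjacent i and j lie in the support, both are descents of w,
-- so w has a reduced word starting with i j i, and [ σ i , σ i σ j σ i ] is such a chain.
--
-- Conversely, if w is the product of a set S of pairwise commuting generators, then the elements below
-- w are the products of subsets of S, and each subset is recovered as the set of left descents.
module Submission where

open import Algebra.Definitions.RawMagma using (_,_)
open import Data.Fin.Base as Fin using (Fin; zero; suc; inject₁; toℕ; _<_)
import Data.Fin.Properties as Fin
open import Data.Fin.Permutation
  using (Permutation′; _≈_; _⟨$⟩ʳ_; _⟨$⟩ˡ_; id; transpose; inverseˡ; inverseʳ)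
open import Data.Fin.Permutation.Transposition.List
  using (TranspositionList; eval; decompose; eval-decompose)
open import Data.Fin.Subset as Subset using (Subset; _⊆_; _∪_; _∩_; ∁)
import Data.Fin.Subset.Properties as Subset
open import Data.List.Base using (List; []; _∷_; [_]; _++_; length; lookup; filter)
import Data.List.Membership.DecPropositional as DecMembership
open import Data.List.Membership.Propositional using () renaming (_∈_ to _∈ₗ_; _∉_ to _∉ₗ_)
open import Data.List.Membership.Propositional.Properties
  using (∈-∃++; ∈-filter⁺; ∈-filter⁻; ∈-lookup; ∈-++⁺ˡ; ∈-++⁺ʳ; ∈-++⁻)
open import Data.List.Properties using (length-++; ++-assoc; ++-identityʳ)
open import Data.List.Relation.Binary.Permutation.Propositional
  using (_↭_; refl; prep; swap; ↭-sym; ↭-trans; ↭⇒↭ₛ)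
open import Data.List.Relation.Binary.Permutation.Propositional.Properties
  using (shift; ∈-resp-↭; ↭-length)
import Data.List.Relation.Binary.Permutation.Setoid.Properties as PermutationSetoid
open import Data.List.Relation.Binary.Prefix.Propositional.Properties using (∣ˡ-as-Prefix; Prefix-as-∣ˡ)
open import Data.List.Relation.Unary.All as All using (All; []; _∷_)
import Data.List.Relation.Unary.All.Properties as All
open import Data.List.Relation.Unary.AllPairs as AllPairs using (AllPairs; []; _∷_)
import Data.List.Relation.Unary.AllPairs.Properties as AllPairs
open import Data.List.Relation.Unary.Any as Any using (here; there)
open import Data.List.Relation.Unary.Any.Properties using (lookup-index)
open import Data.List.Relation.Unary.Unique.Propositional using (Unique)
open import Data.Nat.Base as ℕ using (ℕ; zero; suc; s≤s; z≤n)
import Data.Nat.Properties as ℕ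
open import Data.Product.Base using (∃; ∃-syntax; _×_; _,_; proj₁; proj₂)
open import Data.Sum.Base as Sum using (_⊎_; inj₁; inj₂)
open import Data.Vec.Base as Vec using (tabulate)
open import Data.Vec.Properties using (lookup∘tabulate; lookup⇒[]=; []=⇒lookup)
open import Function.Base using (_∘_)
open import Function.Bundles using (_⇔_; mk⇔; Equivalence)
open import Level using (0ℓ)
open import Relation.Binary.Core using (Rel)
open import Relation.Binary.Definitions using (Reflexive; tri<; tri≈; tri>)
open import Relation.Binary.Morphism.Structures using (IsOrderIsomorphism)
open import Relation.Binary.PropositionalEquality
  using (_≡_; _≢_; refl; sym; trans; cong; cong₂; subst; subst₂; setoid; resp₂; module ≡-Reasoning)
open import Relation.Nullary using (¬_; Dec; yes; no; does; proof; contradiction)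
open import Relation.Nullary.Decidable as Dec using (dec-true; dec-false; _×-dec_; _⊎-dec_)
open import Relation.Nullary.Reflects using (Reflects; invert)
open import Relation.Unary using (Pred; _∈_)
open import Defs

private
  variable
    n : ℕ

-- Transpositions and conjugation

transpose-matchˡ : (x y : Fin n) → transpose x y ⟨$⟩ʳ x ≡ y
transpose-matchˡ x y rewrite dec-true (x Fin.≟ x) refl = refl

transpose-matchʳ : (x y : Fin n) → transpose x y ⟨$⟩ʳ y ≡ x
transpose-matchʳ x y with y Fin.≟ x
... | yes y≡x = y≡x
... | no  _   rewrite dec-true (y Fin.≟ y) refl = refl

transpose-mismatch : {x y k : Fin n} → k ≢ x → k ≢ y → transpose x y ⟨$⟩ʳ k ≡ k
transpose-mismatch {x = x} {y} {k} k≢x k≢y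
  rewrite dec-false (k Fin.≟ x) k≢x | dec-false (k Fin.≟ y) k≢y = refl

⟨$⟩ʳ-injective : (π : Permutation′ n) {x y : Fin n} → π ⟨$⟩ʳ x ≡ π ⟨$⟩ʳ y → x ≡ y
⟨$⟩ʳ-injective π eq = trans (sym (inverseˡ π)) (trans (cong (π ⟨$⟩ˡ_) eq) (inverseˡ π))

⟨$⟩ˡ-injective : (π : Permutation′ n) {x y : Fin n} → π ⟨$⟩ˡ x ≡ π ⟨$⟩ˡ y → x ≡ y
⟨$⟩ˡ-injective π eq = trans (sym (inverseʳ π)) (trans (cong (π ⟨$⟩ʳ_) eq) (inverseʳ π))

-- `_≈_` compares forward maps only, whereas descents are read off the inverse; this carries an
-- equality over.
⟨$⟩ˡ-cong : (π ρ : Permutation′ n) → π ≈ ρ → ∀ x → π ⟨$⟩ˡ x ≡ ρ ⟨$⟩ˡ x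
⟨$⟩ˡ-cong π ρ π≈ρ x = ⟨$⟩ʳ-injective ρ
  (trans (sym (π≈ρ _)) (trans (inverseʳ π) (sym (inverseʳ ρ))))

data Hits (x y : Fin n) : Fin n → Set where
  fst     : Hits x y x
  snd     : Hits x y y
  neither : ∀ {k} → k ≢ x → k ≢ y → Hits x y k

hits : (x y k : Fin n) → Hits x y k
hits x y k with k Fin.≟ x | k Fin.≟ y
... | yes refl | _        = fst
... | no _     | yes refl = snd
... | no k≢x   | no k≢y   = neither k≢x k≢y

transpose-conj : (π : Permutation′ n) (x y k : Fin n) →
  π ⟨$⟩ʳ (transpose x y ⟨$⟩ʳ k) ≡ transpose (π ⟨$⟩ʳ x) (π ⟨$⟩ʳ y) ⟨$⟩ʳ (π ⟨$⟩ʳ k)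
transpose-conj π x y k with hits x y k
... | fst             = trans (cong (π ⟨$⟩ʳ_) (transpose-matchˡ x y))
  (sym (transpose-matchˡ (π ⟨$⟩ʳ x) (π ⟨$⟩ʳ y)))
... | snd             = trans (cong (π ⟨$⟩ʳ_) (transpose-matchʳ x y))
  (sym (transpose-matchʳ (π ⟨$⟩ʳ x) (π ⟨$⟩ʳ y)))
... | neither k≢x k≢y = trans (cong (π ⟨$⟩ʳ_) (transpose-mismatch k≢x k≢y))
  (sym (transpose-mismatch (k≢x ∘ ⟨$⟩ʳ-injective π) (k≢y ∘ ⟨$⟩ʳ-injective π)))

transpose-comm : (x y : Fin n) → transpose x y ≈ transpose y x
transpose-comm x y k with hits x y k
... | fst             = trans (transpose-matchˡ x y) (sym (transpose-matchʳ y x))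
... | snd             = trans (transpose-matchʳ x y) (sym (transpose-matchˡ y x))
... | neither k≢x k≢y = trans (transpose-mismatch k≢x k≢y) (sym (transpose-mismatch k≢y k≢x))

transpose-refl : (x : Fin n) → transpose x x ≈ id
transpose-refl x k with hits x x k
... | fst           = transpose-matchˡ x x
... | snd           = transpose-matchʳ x x
... | neither k≢x _ = transpose-mismatch k≢x k≢x

-- Generators as swaps of neighbouring points

-- σ i swaps lo i and hi i.  As Gen n does not determine n (both Gen 0 and Gen 1 are empty), n is
-- often given explicitly.
lo hi : Gen n → Fin n
lo {suc _} = inject₁
hi {suc _} = suc

toℕ-lo : (i : Gen n) → toℕ (lo {n} i) ≡ toℕ i
toℕ-lo {suc _} = Fin.toℕ-inject₁

toℕ-hi : (i : Gen n) → toℕ (hi {n} i) ≡ suc (toℕ i)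
toℕ-hi {suc _} i = refl

toℕ-hi-lo : (i : Gen n) → toℕ (hi {n} i) ≡ suc (toℕ (lo {n} i))
toℕ-hi-lo i = trans (toℕ-hi i) (cong suc (sym (toℕ-lo i)))

lo<hi : (i : Gen n) → lo {n} i < hi {n} i
lo<hi i = ℕ.≤-reflexive (sym (toℕ-hi-lo i))

lo≢hi : (i : Gen n) → lo {n} i ≢ hi {n} i
lo≢hi i = Fin.<⇒≢ (lo<hi i)

lo-injective : {i j : Gen n} → lo {n} i ≡ lo {n} j → i ≡ j
lo-injective {i = i} {j} eq = Fin.toℕ-injective
  (trans (sym (toℕ-lo i)) (trans (cong toℕ eq) (toℕ-lo j)))

hi-injective : {i j : Gen n} → hi {n} i ≡ hi {n} j → i ≡ j
hi-injective {i = i} {j} eq = Fin.toℕ-injective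
  (ℕ.suc-injective (trans (sym (toℕ-hi i)) (trans (cong toℕ eq) (toℕ-hi j))))

hi≡lo : {i j : Gen n} → toℕ j ≡ suc (toℕ i) → hi {n} i ≡ lo {n} j
hi≡lo {i = i} {j} eq = Fin.toℕ-injective (trans (toℕ-hi i) (trans (sym eq) (sym (toℕ-lo j))))

hi-surjective : {x y : Fin n} → x < y → ∃[ i ] hi i ≡ y
hi-surjective {y = suc i} _ = i , refl

lo<⇒hi< : {i : Gen n} {y : Fin n} → lo {n} i < y → y ≢ hi {n} i → hi i < y
lo<⇒hi< {i = i} lo<y y≢hi = ℕ.≤∧≢⇒< (ℕ.≤-trans (ℕ.≤-reflexive (toℕ-hi-lo i)) lo<y)
  (y≢hi ∘ sym ∘ Fin.toℕ-injective)

<hi⇒<lo : {i : Gen n} {x : Fin n} → x < hi {n} i → x ≢ lo {n} i → x < lo {n} i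
<hi⇒<lo {i = i} x<hi x≢lo = ℕ.≤∧≢⇒< (ℕ.s≤s⁻¹ (ℕ.≤-trans x<hi (ℕ.≤-reflexive (toℕ-hi-lo i))))
  (x≢lo ∘ Fin.toℕ-injective)

σ-transpose : (i : Gen n) → σ {n} i ≈ transpose (lo {n} i) (hi {n} i)
σ-transpose {suc _} i k = refl

σ-lo : (i : Gen n) → σ {n} i ⟨$⟩ʳ lo {n} i ≡ hi {n} i
σ-lo i = trans (σ-transpose i _) (transpose-matchˡ (lo i) (hi i))

σ-hi : (i : Gen n) → σ {n} i ⟨$⟩ʳ hi {n} i ≡ lo {n} i
σ-hi i = trans (σ-transpose i _) (transpose-matchʳ (lo i) (hi i))

σ-fix : {i : Gen n} {k : Fin n} → k ≢ lo {n} i → k ≢ hi {n} i → σ {n} i ⟨$⟩ʳ k ≡ k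
σ-fix {i = i} k≢lo k≢hi = trans (σ-transpose i _) (transpose-mismatch k≢lo k≢hi)

σ-involutive : (i : Gen n) → σ {n} i · σ {n} i ≈ id
σ-involutive i k with hits (lo i) (hi i) k
... | fst               = trans (cong (σ i ⟨$⟩ʳ_) (σ-lo i)) (σ-hi i)
... | snd               = trans (cong (σ i ⟨$⟩ʳ_) (σ-hi i)) (σ-lo i)
... | neither k≢lo k≢hi = trans (cong (σ i ⟨$⟩ʳ_) (σ-fix k≢lo k≢hi)) (σ-fix k≢lo k≢hi)

σ-inverse : (i : Gen n) (k : Fin n) → σ {n} i ⟨$⟩ˡ k ≡ σ {n} i ⟨$⟩ʳ k
σ-inverse i k = trans (cong (σ i ⟨$⟩ˡ_) (sym (σ-involutive i k))) (inverseˡ (σ i))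

σ-cancel : {i : Gen n} {u v : Permutation′ n} → σ {n} i · u ≈ v → u ≈ σ {n} i · v
σ-cancel {i = i} eq k = trans (sym (σ-involutive i _)) (cong (σ i ⟨$⟩ʳ_) (eq k))

-- No point lies strictly between `lo i` and `hi i`, so this is the only pair whose order `σ i` can
-- reverse.
σ-mono-< : (i : Gen n) {x y : Fin n} → x < y → ¬ (x ≡ lo i × y ≡ hi i) →
  σ i ⟨$⟩ʳ x < σ i ⟨$⟩ʳ y
σ-mono-< i {x} {y} x<y ≢ with hits (lo i) (hi i) x | hits (lo i) (hi i) y
... | fst               | fst               = contradiction x<y (Fin.<-irrefl refl)
... | fst               | snd               = contradiction (refl , refl) ≢
... | fst               | neither y≢lo y≢hi =
  subst₂ _<_ (sym (σ-lo i)) (sym (σ-fix y≢lo y≢hi)) (lo<⇒hi< x<y y≢hi)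
... | snd               | fst               = contradiction x<y (Fin.<-asym (lo<hi i))
... | snd               | snd               = contradiction x<y (Fin.<-irrefl refl)
... | snd               | neither y≢lo y≢hi =
  subst₂ _<_ (sym (σ-hi i)) (sym (σ-fix y≢lo y≢hi)) (Fin.<-trans (lo<hi i) x<y)
... | neither x≢lo x≢hi | fst               =
  subst₂ _<_ (sym (σ-fix x≢lo x≢hi)) (sym (σ-lo i)) (Fin.<-trans x<y (lo<hi i))
... | neither x≢lo x≢hi | snd               =
  subst₂ _<_ (sym (σ-fix x≢lo x≢hi)) (sym (σ-hi i)) (<hi⇒<lo x<y x≢lo)
... | neither x≢lo x≢hi | neither y≢lo y≢hi =
  subst₂ _<_ (sym (σ-fix x≢lo x≢hi)) (sym (σ-fix y≢lo y≢hi)) x<y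

-- Words for arbitrary permutations

product-++ : (a b : Word n) → product {n} (a ++ b) ≈ product a · product b
product-++ []      b k = refl
product-++ {n} (i ∷ a) b k = cong (σ i ⟨$⟩ʳ_) (product-++ {n} a b k)

-- Induction on a bound for the larger point `hi i`: unless x is `lo i`, `σ i` fixes x, so
-- conjugating `transpose x (lo i)` by `σ i` gives `transpose x (hi i)`.
<-transpose-word : ∀ d {x y : Fin n} → toℕ y ℕ.≤ d → x < y → ∃[ a ] product a ≈ transpose x y
<-transpose-word zero y≤0 x<y = contradiction (ℕ.≤-trans x<y y≤0) λ ()
<-transpose-word {n} (suc d) {x} {y} y≤d x<y with i , refl ← hi-surjective x<y with x Fin.≟ lo i
... | yes refl = [ i ] , σ-transpose i
... | no x≢lo
  with a , eq ← <-transpose-word d {x} {lo i}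
         (ℕ.s≤s⁻¹ (ℕ.≤-trans (ℕ.≤-reflexive (sym (toℕ-hi-lo i))) y≤d)) (<hi⇒<lo x<y x≢lo)
  = i ∷ a ++ [ i ] , λ k → begin
    σ i ⟨$⟩ʳ (product {n} (a ++ [ i ]) ⟨$⟩ʳ k)
      ≡⟨ cong (σ i ⟨$⟩ʳ_) (product-++ {n} a [ i ] k) ⟩
    σ i ⟨$⟩ʳ (product a ⟨$⟩ʳ (σ i ⟨$⟩ʳ k))
      ≡⟨ cong (σ i ⟨$⟩ʳ_) (eq _) ⟩
    σ i ⟨$⟩ʳ (transpose x (lo i) ⟨$⟩ʳ (σ i ⟨$⟩ʳ k))
      ≡⟨ transpose-conj (σ i) x (lo i) _ ⟩
    transpose (σ i ⟨$⟩ʳ x) (σ i ⟨$⟩ʳ lo i) ⟨$⟩ʳ (σ i ⟨$⟩ʳ (σ i ⟨$⟩ʳ k))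
      ≡⟨ cong (transpose (σ i ⟨$⟩ʳ x) (σ i ⟨$⟩ʳ lo i) ⟨$⟩ʳ_) (σ-involutive i k) ⟩
    transpose (σ i ⟨$⟩ʳ x) (σ i ⟨$⟩ʳ lo i) ⟨$⟩ʳ k
      ≡⟨ cong₂ (λ u v → transpose u v ⟨$⟩ʳ k) (σ-fix x≢lo (Fin.<⇒≢ x<y)) (σ-lo i) ⟩
    transpose x (hi i) ⟨$⟩ʳ k ∎
  where open ≡-Reasoning

transpose-word : (x y : Fin n) → ∃[ a ] product a ≈ transpose x y
transpose-word x y with Fin.<-cmp x y
... | tri< x<y _ _ = <-transpose-word _ ℕ.≤-refl x<y
... | tri≈ _ refl _ = [] , sym ∘ transpose-refl x
... | tri> _ _ y<x with a , eq ← <-transpose-word _ ℕ.≤-refl y<x =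
  a , λ k → trans (eq k) (transpose-comm y x k)

eval-word : (xs : TranspositionList n) → ∃[ a ] product a ≈ eval xs
eval-word [] = [] , λ _ → refl
eval-word {n} ((x , y) ∷ xs) with a , eqa ← eval-word xs | b , eqb ← transpose-word x y =
  -- `eval` applies the head of the list first and `product` applies the last letter first, so the
  -- word of the head goes to the right.
  a ++ b , λ k → trans (product-++ {n} a b k) (trans (eqa _) (cong (eval xs ⟨$⟩ʳ_) (eqb k)))

word : (w : Permutation′ n) → ∃[ a ] product a ≈ w
word w with a , eq ← eval-word (decompose w) = a , λ k → trans (eq k) (eval-decompose w k)

-- Left descents and the deletion property

-- A left descent of w, read off the one-line notation of w⁻¹.  Being a record rather than a function,
-- it determines w and i for unification; the same holds for Reduced below.
record Descent (w : Permutation′ n) (i : Gen n) : Set where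
  constructor descent
  field inverted : w ⟨$⟩ˡ hi i < w ⟨$⟩ˡ lo i

open Descent public

descent? : (w : Permutation′ n) (i : Gen n) → Dec (Descent w i)
descent? w i = Dec.map′ descent inverted ((w ⟨$⟩ˡ hi i) Fin.<? (w ⟨$⟩ˡ lo i))

¬descent⇒< : {w : Permutation′ n} {i : Gen n} → ¬ Descent w i → w ⟨$⟩ˡ lo i < w ⟨$⟩ˡ hi i
¬descent⇒< {w = w} {i} ¬d with Fin.<-cmp (w ⟨$⟩ˡ lo i) (w ⟨$⟩ˡ hi i)
... | tri< lt _ _ = lt
... | tri≈ _ eq _ = contradiction (⟨$⟩ˡ-injective w eq) (lo≢hi i)
... | tri> _ _ gt = contradiction (descent gt) ¬d

descent-resp : {u v : Permutation′ n} {i : Gen n} → u ≈ v → Descent u i → Descent v i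
descent-resp {u = u} {v} u≈v (descent d) =
  descent (subst₂ _<_ (⟨$⟩ˡ-cong u v u≈v _) (⟨$⟩ˡ-cong u v u≈v _) d)

σ·-⟨$⟩ˡ : (w : Permutation′ n) {i : Gen n} {x y : Fin n} → σ i ⟨$⟩ʳ x ≡ y → (σ i · w) ⟨$⟩ˡ x ≡ w ⟨$⟩ˡ y
σ·-⟨$⟩ˡ w eq = cong (w ⟨$⟩ˡ_) (trans (σ-inverse _ _) eq)

σ·-lo : (w : Permutation′ n) (i : Gen n) → (σ i · w) ⟨$⟩ˡ lo i ≡ w ⟨$⟩ˡ hi i
σ·-lo w i = σ·-⟨$⟩ˡ w (σ-lo i)

σ·-hi : (w : Permutation′ n) (i : Gen n) → (σ i · w) ⟨$⟩ˡ hi i ≡ w ⟨$⟩ˡ lo i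
σ·-hi w i = σ·-⟨$⟩ˡ w (σ-hi i)

-- Left multiplication by `σ i` exchanges the entries of w⁻¹ at `lo i` and `hi i`.
¬descent⇒descent-σ· : {w : Permutation′ n} {i : Gen n} → ¬ Descent w i → Descent (σ i · w) i
¬descent⇒descent-σ· {w = w} {i} ¬d =
  descent (subst₂ _<_ (sym (σ·-hi w i)) (sym (σ·-lo w i)) (¬descent⇒< ¬d))

-- Apply the letters of a in turn to the pair x < y: as the final images are inverted, some letter
-- reverses the pair, and then swaps exactly its two elements.  Deleting that letter multiplies the
-- product by transpose x y.
deletion : (a : Word n) {x y : Fin n} → x < y → product a ⟨$⟩ˡ y < product a ⟨$⟩ˡ x →
  ∃[ b ] (length a ≡ suc (length b) × product b ≈ transpose x y · product a)
deletion []      x<y y<x = contradiction y<x (Fin.<-asym x<y)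
deletion (j ∷ a) {x} {y} x<y inv with (x Fin.≟ lo j) ×-dec (y Fin.≟ hi j)
... | yes (refl , refl) = a , refl , λ k →
  trans (sym (σ-involutive j _)) (σ-transpose j _)
... | no ≢ with b , len , eq ← deletion a (σ-mono-< j x<y ≢)
                 (subst₂ (λ s t → product a ⟨$⟩ˡ s < product a ⟨$⟩ˡ t) (σ-inverse j y) (σ-inverse j x) inv)
  = j ∷ b , cong suc len , λ k → begin
    σ j ⟨$⟩ʳ (product b ⟨$⟩ʳ k)
      ≡⟨ cong (σ j ⟨$⟩ʳ_) (eq k) ⟩
    σ j ⟨$⟩ʳ (transpose (σ j ⟨$⟩ʳ x) (σ j ⟨$⟩ʳ y) ⟨$⟩ʳ (product a ⟨$⟩ʳ k))
      ≡⟨ transpose-conj (σ j) _ _ _ ⟩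
    transpose (σ j ⟨$⟩ʳ (σ j ⟨$⟩ʳ x)) (σ j ⟨$⟩ʳ (σ j ⟨$⟩ʳ y)) ⟨$⟩ʳ (product (j ∷ a) ⟨$⟩ʳ k)
      ≡⟨ cong₂ (λ s t → transpose s t ⟨$⟩ʳ (product (j ∷ a) ⟨$⟩ʳ k)) (σ-involutive j x) (σ-involutive j y) ⟩
    transpose x y ⟨$⟩ʳ (product (j ∷ a) ⟨$⟩ʳ k) ∎
  where open ≡-Reasoning

-- Reduced words

record Reduced (a : Word n) (w : Permutation′ n) : Set where
  constructor reduced
  field
    product-≈ : product a ≈ w
    minimal   : (b : Word n) → product b ≈ w → length a ℕ.≤ length b

open Reduced public

toReduced : {a : Word n} {w : Permutation′ n} → IsReducedDecomposition a w → Reduced a w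
toReduced (eq , min) = reduced eq min

fromReduced : {a : Word n} {w : Permutation′ n} → Reduced a w → IsReducedDecomposition a w
fromReduced (reduced eq min) = eq , min

reduced-resp : {u v : Permutation′ n} {a : Word n} → u ≈ v → Reduced a u → Reduced a v
reduced-resp u≈v (reduced eq min) =
  reduced (λ k → trans (eq k) (u≈v k)) λ b b≈v → min b λ k → trans (b≈v k) (sym (u≈v k))

reduced-length : {w : Permutation′ n} {a b : Word n} → product b ≈ w → length b ≡ length a →
  Reduced a w → Reduced b w
reduced-length b≈w |b|≡|a| (reduced _ min) =
  reduced b≈w λ c c≈w → ℕ.≤-trans (ℕ.≤-reflexive |b|≡|a|) (min c c≈w)

-- The deletion property at the pair `lo i < hi i`, whose transposition is `σ i`. It shortens every
-- word of `w`, reduced or not.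
delete : {w : Permutation′ n} {i : Gen n} → Descent w i → (a : Word n) → product a ≈ w →
  ∃[ b ] (length a ≡ suc (length b) × product b ≈ σ i · w)
delete {i = i} d a a≈w
  with b , len , eq ← deletion a (lo<hi i) (inverted (descent-resp {v = product a} (sym ∘ a≈w) d))
  = b , len , λ k → trans (eq k) (trans (sym (σ-transpose i _)) (cong (σ i ⟨$⟩ʳ_) (a≈w k)))

tail-reduced : {w : Permutation′ n} {i : Gen n} {a : Word n} →
  Reduced (i ∷ a) w → Reduced a (σ i · w)
tail-reduced {w = w} {i} {a} (reduced eq min) = reduced
  (σ-cancel {u = product a} {v = w} eq)
  λ b b≈ → ℕ.s≤s⁻¹ (min (i ∷ b) λ k → trans (cong (σ i ⟨$⟩ʳ_) (b≈ k)) (σ-involutive i _))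

-- By `delete`, any competing word of `w` loses a letter to become a word of `σ i · w`, so it has at
-- least one letter more than `a`.
∷-reduced : {w : Permutation′ n} {i : Gen n} {a : Word n} → Descent w i →
  Reduced a (σ i · w) → Reduced (i ∷ a) w
∷-reduced {i = i} d (reduced eq min) = reduced
  (λ k → trans (cong (σ i ⟨$⟩ʳ_) (eq k)) (σ-involutive i _))
  λ b b≈ → let c , len , c≈ = delete d b b≈ in
    ℕ.≤-trans (s≤s (min c c≈)) (ℕ.≤-reflexive (sym len))

-- Otherwise `i` would be a descent of `σ i · w`, and deleting a letter from `a` would give a word
-- of `w` two letters shorter than `i ∷ a`.
∷-reduced⇒descent : {w : Permutation′ n} {i : Gen n} {a : Word n} → Reduced (i ∷ a) w → Descent w i
∷-reduced⇒descent {w = w} {i} {a} red with descent? w i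
... | yes d = d
... | no ¬d with b , len , b≈ ← delete (¬descent⇒descent-σ· ¬d) a (product-≈ (tail-reduced red))
  = contradiction (ℕ.≤-trans (ℕ.≤-trans (ℕ.n≤1+n _) (s≤s (ℕ.≤-reflexive (sym len))))
      (minimal red b λ k → trans (b≈ k) (σ-involutive i _))) (ℕ.<-irrefl refl)

-- The exchange property: deleting a letter of `a` and prepending `i` preserves both product and
-- length, hence minimality.
descent⇒∷-reduced : {w : Permutation′ n} {i : Gen n} {a : Word n} → Descent w i → Reduced a w →
  ∃[ b ] (length a ≡ suc (length b) × Reduced (i ∷ b) w)
descent⇒∷-reduced {i = i} {a} d red
  with b , len , b≈ ← delete d a (product-≈ red)
  = b , len , reduced-length
      (λ k → trans (cong (σ i ⟨$⟩ʳ_) (b≈ k)) (σ-involutive i _)) (sym len) red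

[]-reduced : Reduced {n} [] id
[]-reduced = reduced (λ _ → refl) λ _ _ → z≤n

-- Prepending i to a reduced word of a permutation u gives a reduced word unless u has descent i, in
-- which case the exchange property rewrites the word of u to start with i.
reduced-product : (a : Word n) → ∃[ b ] Reduced b (product {n} a)
reduced-product []      = [] , []-reduced
reduced-product {n} (i ∷ a) with b , red ← reduced-product {n} a | descent? (product a) i
... | yes d = let c , _ , red′ = descent⇒∷-reduced d red in c , tail-reduced red′
... | no ¬d = i ∷ b , ∷-reduced (¬descent⇒descent-σ· ¬d) (reduced-resp (λ _ → sym (σ-involutive i _)) red)

reduced-word : (w : Permutation′ n) → ∃[ a ] Reduced a w
reduced-word {n} w with a , eq ← word w with b , red ← reduced-product {n} a =
  b , reduced-resp eq red

++-reducedˡ : {w : Permutation′ n} (a b : Word n) → Reduced (a ++ b) w → Reduced a (product {n} a)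
++-reducedˡ {n} a b (reduced eq min) = reduced (λ _ → refl) λ c c≈a → ℕ.+-cancelʳ-≤ (length b) _ _
  (subst₂ ℕ._≤_ (length-++ a) (length-++ c) (min (c ++ b) λ k → trans (product-++ {n} c b k)
    (trans (c≈a _) (trans (sym (product-++ {n} a b k)) (eq k)))))

++-reducedʳ : {w : Permutation′ n} (a b : Word n) → Reduced (a ++ b) w → Reduced b (product {n} b)
++-reducedʳ {n} a b (reduced eq min) = reduced (λ _ → refl) λ c c≈b → ℕ.+-cancelˡ-≤ (length a) _ _
  (subst₂ ℕ._≤_ (length-++ a) (length-++ a) (min (a ++ c) λ k → trans (product-++ {n} a c k)
    (trans (cong (product a ⟨$⟩ʳ_) (c≈b k)) (trans (sym (product-++ {n} a b k)) (eq k)))))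

replace-prefix : {w : Permutation′ n} (a b c : Word n) → product {n} a ≈ product c → length c ≡ length a →
  Reduced (a ++ b) w → Reduced (c ++ b) w
replace-prefix {n} a b c a≈c len red = reduced-length
  (λ k → trans (product-++ {n} c b k) (trans (sym (a≈c _))
    (trans (sym (product-++ {n} a b k)) (product-≈ red k))))
  (trans (length-++ c) (trans (cong (ℕ._+ length b) len) (sym (length-++ a)))) red

replace-suffix : {w : Permutation′ n} (a b c : Word n) → product {n} b ≈ product c → length c ≡ length b →
  Reduced (a ++ b) w → Reduced (a ++ c) w
replace-suffix {n} a b c b≈c len red = reduced-length
  (λ k → trans (product-++ {n} a c k) (trans (cong (product a ⟨$⟩ʳ_) (sym (b≈c _)))
    (trans (sym (product-++ {n} a b k)) (product-≈ red k))))
  (trans (length-++ a) (trans (cong (length a ℕ.+_) len) (sym (length-++ a)))) red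

reduced-length-≡ : {w : Permutation′ n} {a b : Word n} → Reduced a w → Reduced b w → length a ≡ length b
reduced-length-≡ {a = a} {b} (reduced a≈ a-min) (reduced b≈ b-min) = ℕ.≤-antisym (a-min b b≈) (b-min a a≈)

-- The weak order and descents

prefix⇒≤wk : {w : Permutation′ n} (a b : Word n) → Reduced (a ++ b) w → product a ≤wk w
prefix⇒≤wk a b red = a , a ++ b , fromReduced (++-reducedˡ a b red) , fromReduced red , ∣ˡ-as-Prefix (b , refl)

≤wk⇒prefix : {v w : Permutation′ n} → v ≤wk w → ∃[ a ] ∃[ b ] (Reduced a v × Reduced (a ++ b) w)
≤wk⇒prefix {v = v} {w} (a , b , a-red , b-red , p) with c , refl ← Prefix-as-∣ˡ p =
  a , c , toReduced {a = a} {w = v} a-red , toReduced {a = b} {w = w} b-red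

≤wk-resp : {u u′ v v′ : Permutation′ n} → u ≈ u′ → v ≈ v′ → u ≤wk v → u′ ≤wk v′
≤wk-resp {u = u} {u′} {v} {v′} u≈u′ v≈v′ (a , b , a-red , b-red , p) = a , b ,
  fromReduced {w = u′} (reduced-resp u≈u′ (toReduced {a = a} {w = u} a-red)) ,
  fromReduced {w = v′} (reduced-resp v≈v′ (toReduced {a = b} {w = v} b-red)) ,
  p

≤wk⇒length-≤ : {v w : Permutation′ n} {a b : Word n} → v ≤wk w → Reduced a v → Reduced b w →
  length a ℕ.≤ length b
≤wk⇒length-≤ {v = v} {w} v≤w a-red b-red with c , d , c-red , cd-red ← ≤wk⇒prefix {v = v} {w} v≤w =
  subst₂ ℕ._≤_ (reduced-length-≡ c-red a-red)
    (trans (sym (length-++ c)) (reduced-length-≡ cd-red b-red)) (ℕ.m≤m+n (length c) (length d))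

-- Some reduced word of `v` extends one of `u`. The exchange property makes that prefix start with
-- `i`, and the first letter of a reduced word is a descent.
descent-mono : {u v : Permutation′ n} {i : Gen n} → u ≤wk v → Descent u i → Descent v i
descent-mono {u = u} {v} {i} u≤v d
  with a , b , a-red , ab-red ← ≤wk⇒prefix {v = u} {v} u≤v
  with c , len , ic-red ← descent⇒∷-reduced d a-red
  = ∷-reduced⇒descent (replace-prefix a b (i ∷ c)
      (λ k → trans (product-≈ a-red k) (sym (product-≈ ic-red k))) (sym len) ab-red)

descent-σ : (i : Gen n) → Descent (σ {n} i) i
descent-σ i = ¬descent⇒descent-σ· {w = id} (Fin.<-asym (lo<hi i) ∘ inverted)

σ≤wk⇒descent : {w : Permutation′ n} {i : Gen n} → σ i ≤wk w → Descent w i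
σ≤wk⇒descent {w = w} {i} σ≤w = descent-mono {u = σ i} {v = w} σ≤w (descent-σ i)

descent⇒σ≤wk : {w : Permutation′ n} {i : Gen n} → Descent w i → σ i ≤wk w
descent⇒σ≤wk {w = w} {i} d with a , red ← reduced-word w with b , _ , red′ ← descent⇒∷-reduced d red =
  ≤wk-resp {u = product [ i ]} {u′ = σ i} {v = w} {v′ = w}
    (λ _ → refl) (λ _ → refl) (prefix⇒≤wk [ i ] b red′)

-- Adjacent and commuting generators

Adjacent : {m : ℕ} → Fin m → Fin m → Set
Adjacent i j = toℕ j ≡ suc (toℕ i) ⊎ toℕ i ≡ suc (toℕ j)

-- Distinctness is included so that a pairwise far word has no repeated letters.
Far : {m : ℕ} → Fin m → Fin m → Set
Far i j = i ≢ j × ¬ Adjacent i j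

private
  variable
    m : ℕ

Far-sym : {i j : Fin m} → Far i j → Far j i
Far-sym (i≢j , ¬adj) = i≢j ∘ sym , ¬adj ∘ Sum.swap

data Position (i : Fin m) : Fin m → Set where
  same     : Position i i
  adjacent : ∀ {j} → Adjacent i j → Position i j
  far      : ∀ {j} → Far i j → Position i j

position : (i j : Fin m) → Position i j
position i j with i Fin.≟ j | (toℕ j ℕ.≟ suc (toℕ i)) ⊎-dec (toℕ i ℕ.≟ suc (toℕ j))
... | yes refl | _       = same
... | no _     | yes adj = adjacent adj
... | no i≢j   | no ¬adj = far (i≢j , ¬adj)

lo≡hi⇒adjacent : {i j : Gen n} → lo {n} i ≡ hi j → toℕ i ≡ suc (toℕ j)
lo≡hi⇒adjacent {i = i} {j} eq = trans (sym (toℕ-lo i)) (trans (cong toℕ eq) (toℕ-hi j))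

far-lo : {i j : Gen n} → Far i j → σ {n} i ⟨$⟩ʳ lo j ≡ lo j
far-lo (i≢j , ¬adj) = σ-fix (i≢j ∘ sym ∘ lo-injective) (¬adj ∘ inj₁ ∘ lo≡hi⇒adjacent)

far-hi : {i j : Gen n} → Far i j → σ {n} i ⟨$⟩ʳ hi j ≡ hi j
far-hi (i≢j , ¬adj) = σ-fix (¬adj ∘ inj₂ ∘ lo≡hi⇒adjacent ∘ sym) (i≢j ∘ sym ∘ hi-injective)

-- `σ i` fixes both points that `σ j` swaps, so conjugation by `σ i` leaves `σ j` unchanged.
far⇒commute : {i j : Gen n} → Far i j → σ {n} i · σ j ≈ σ j · σ i
far⇒commute {i = i} {j} f k = begin
  σ i ⟨$⟩ʳ (σ j ⟨$⟩ʳ k)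
    ≡⟨ cong (σ i ⟨$⟩ʳ_) (σ-transpose j k) ⟩
  σ i ⟨$⟩ʳ (transpose (lo j) (hi j) ⟨$⟩ʳ k)
    ≡⟨ transpose-conj (σ i) (lo j) (hi j) k ⟩
  transpose (σ i ⟨$⟩ʳ lo j) (σ i ⟨$⟩ʳ hi j) ⟨$⟩ʳ (σ i ⟨$⟩ʳ k)
    ≡⟨ cong₂ (λ x y → transpose x y ⟨$⟩ʳ (σ i ⟨$⟩ʳ k)) (far-lo f) (far-hi f) ⟩
  transpose (lo j) (hi j) ⟨$⟩ʳ (σ i ⟨$⟩ʳ k)
    ≡⟨ sym (σ-transpose j _) ⟩
  σ j ⟨$⟩ʳ (σ i ⟨$⟩ʳ k) ∎
  where open ≡-Reasoning

module _ {i j : Gen n} (next : toℕ j ≡ suc (toℕ i)) where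

  private
    lo<lo : lo {n} i < lo {n} j
    lo<lo = subst (lo {n} i <_) (hi≡lo next) (lo<hi i)

    hi<hi : hi {n} i < hi {n} j
    hi<hi = subst (_< hi {n} j) (sym (hi≡lo next)) (lo<hi j)

  σ-pred-lo : σ {n} i ⟨$⟩ʳ lo j ≡ lo i
  σ-pred-lo = trans (cong (σ i ⟨$⟩ʳ_) (sym (hi≡lo next))) (σ-hi i)

  σ-pred-hi : σ {n} i ⟨$⟩ʳ hi j ≡ hi j
  σ-pred-hi = σ-fix (Fin.<⇒≢ (Fin.<-trans (lo<hi i) hi<hi) ∘ sym) (Fin.<⇒≢ hi<hi ∘ sym)

  σ-suc-lo : σ {n} j ⟨$⟩ʳ lo i ≡ lo i
  σ-suc-lo = σ-fix (Fin.<⇒≢ lo<lo) (Fin.<⇒≢ (Fin.<-trans lo<lo (lo<hi j)))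

  σ-suc-hi : σ {n} j ⟨$⟩ʳ hi i ≡ hi j
  σ-suc-hi = trans (cong (σ j ⟨$⟩ʳ_) (hi≡lo next)) (σ-lo j)

  -- The two products differ at `lo i`: one sends it to `hi i`, the other to `hi j`.
  consecutive⇒¬commute : ¬ (σ {n} i · σ j ≈ σ j · σ i)
  consecutive⇒¬commute eq = Fin.<⇒≢ hi<hi (begin
    hi i                     ≡⟨ sym (σ-lo i) ⟩
    σ i ⟨$⟩ʳ lo i            ≡⟨ cong (σ i ⟨$⟩ʳ_) (sym σ-suc-lo) ⟩
    σ i ⟨$⟩ʳ (σ j ⟨$⟩ʳ lo i) ≡⟨ eq (lo i) ⟩
    σ j ⟨$⟩ʳ (σ i ⟨$⟩ʳ lo i) ≡⟨ cong (σ j ⟨$⟩ʳ_) (σ-lo i) ⟩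
    σ j ⟨$⟩ʳ hi i            ≡⟨ σ-suc-hi ⟩
    hi j                     ∎)
    where open ≡-Reasoning

adjacent⇒¬commute : {i j : Gen n} → Adjacent i j → ¬ (σ {n} i · σ j ≈ σ j · σ i)
adjacent⇒¬commute {n} (inj₁ next) eq = consecutive⇒¬commute next eq
adjacent⇒¬commute {n} (inj₂ prev) eq = consecutive⇒¬commute prev (sym ∘ eq)

-- Products of pairwise far generators

far-∉ : {i : Fin m} {a : List (Fin m)} → All (Far i) a → i ∉ₗ a
far-∉ i∥a i∈a = proj₁ (All.lookup i∥a i∈a) refl

far⇒descent-σ· : {w : Permutation′ n} {i j : Gen n} → Far i j → Descent w j → Descent (σ i · w) j
far⇒descent-σ· {w = w} {i} {j} f (descent d) = descent (subst₂ (λ x y → w ⟨$⟩ˡ x < w ⟨$⟩ˡ y)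
  (sym (trans (σ-inverse i _) (far-hi f))) (sym (trans (σ-inverse i _) (far-lo f))) d)

far⇒descent-σ·⁻ : {w : Permutation′ n} {i j : Gen n} → Far i j → Descent (σ i · w) j → Descent w j
far⇒descent-σ·⁻ {w = w} {i} {j} f (descent d) = descent (subst₂ (λ x y → w ⟨$⟩ˡ x < w ⟨$⟩ˡ y)
  (trans (σ-inverse i _) (far-hi f)) (trans (σ-inverse i _) (far-lo f)) d)

-- w⁻¹ increases along the three points moved by `σ i` or `σ j`; exchanging the two entries at `i`
-- leaves the pair at `j` increasing.
adjacent⇒¬descent-σ· : {w : Permutation′ n} {i j : Gen n} → Adjacent i j → ¬ Descent w i → ¬ Descent w j →
  ¬ Descent (σ i · w) j
adjacent⇒¬descent-σ· {n} {w} {i} {j} (inj₁ next) ¬di ¬dj (descent d) = Fin.<-asym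
  (subst₂ _<_ (σ·-⟨$⟩ˡ w (σ-pred-hi next)) (σ·-⟨$⟩ˡ w (σ-pred-lo next)) d)
  (Fin.<-trans (¬descent⇒< ¬di)
    (subst (λ x → w ⟨$⟩ˡ x < w ⟨$⟩ˡ hi j) (sym (hi≡lo next)) (¬descent⇒< ¬dj)))
adjacent⇒¬descent-σ· {n} {w} {i} {j} (inj₂ prev) ¬di ¬dj (descent d) = Fin.<-asym
  (subst₂ _<_ (σ·-⟨$⟩ˡ w (σ-suc-hi prev)) (σ·-⟨$⟩ˡ w (σ-suc-lo prev)) d)
  (Fin.<-trans (subst (λ x → w ⟨$⟩ˡ lo j < w ⟨$⟩ˡ x) (hi≡lo prev) (¬descent⇒< ¬dj)) (¬descent⇒< ¬di))

-- The head is absent from the tail, hence by `descent⇒∈` not a descent of its product, and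
-- prepending it creates the descent. Prepending a far letter preserves the descents already
-- present.
∈⇒descent : {i : Gen n} {a : Word n} → AllPairs Far a → i ∈ₗ a → Descent (product {n} a) i
descent⇒∈ : {i : Gen n} {a : Word n} → AllPairs Far a → Descent (product {n} a) i → i ∈ₗ a

∈⇒descent {a = j ∷ a} (j∥a ∷ a∥) (here refl) =
  ¬descent⇒descent-σ· (far-∉ j∥a ∘ descent⇒∈ a∥)
∈⇒descent {a = j ∷ a} (j∥a ∷ a∥) (there i∈a) =
  far⇒descent-σ· (All.lookup j∥a i∈a) (∈⇒descent a∥ i∈a)

descent⇒∈ {a = []} _ d = contradiction (inverted d) (Fin.<-asym (lo<hi _))
descent⇒∈ {n} {i = i} {j ∷ a} (j∥a ∷ a∥) d with position j i
... | same         = here refl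
... | far f        = there (descent⇒∈ a∥ (far⇒descent-σ·⁻ f d))
-- Neither the head `j` nor its neighbour `i` occurs in the tail, so neither is a descent of the
-- tail's product.
... | adjacent adj = contradiction d (adjacent⇒¬descent-σ· adj
  (far-∉ j∥a ∘ descent⇒∈ a∥) λ d′ → proj₂ (All.lookup j∥a (descent⇒∈ a∥ d′)) adj)

far-reduced : {a : Word n} → AllPairs Far a → Reduced a (product {n} a)
far-reduced [] = []-reduced
far-reduced {n} {i ∷ a} a∥@(_ ∷ a′∥) = ∷-reduced (∈⇒descent a∥ (here refl))
  (reduced-resp (λ _ → sym (σ-involutive i _)) (far-reduced a′∥))

far-resp-↭ : {a b : List (Fin m)} → a ↭ b → AllPairs Far a → AllPairs Far b
far-resp-↭ {m} a↭b = PermutationSetoid.AllPairs-resp-↭ (setoid (Fin m)) Far-sym (resp₂ Far) (↭⇒↭ₛ a↭b)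

product-↭ : {a b : Word n} → a ↭ b → AllPairs Far a → product {n} a ≈ product b
product-↭ refl           _                    k = refl
product-↭ {n} (prep i a↭b)   (_ ∷ a∥)             k = cong (σ i ⟨$⟩ʳ_) (product-↭ {n} a↭b a∥ k)
product-↭ {n} (swap i j a↭b) ((f ∷ _) ∷ _ ∷ a∥) k =
  trans (far⇒commute {n} f _) (cong (λ x → σ j ⟨$⟩ʳ (σ i ⟨$⟩ʳ x)) (product-↭ {n} a↭b a∥ k))
product-↭ {n} (_↭_.trans a↭b b↭c) a∥ k =
  trans (product-↭ {n} a↭b a∥ k) (product-↭ {n} b↭c (far-resp-↭ a↭b a∥) k)

∈⇒↭∷ : {A : Set} {x : A} {xs : List A} → x ∈ₗ xs → ∃[ ys ] xs ↭ x ∷ ys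
∈⇒↭∷ x∈xs with ys , zs , refl ← ∈-∃++ x∈xs = ys ++ zs , shift _ ys zs

-- The first letter of `a` is a descent of the product, hence a letter of `b`. Moving it to the
-- front of `b` and cancelling it leaves a shorter instance.
reduced⇒↭ : {a b : Word n} → AllPairs Far b → Reduced a (product {n} b) → a ↭ b
reduced⇒↭ {a = []} {[]}    _  _ = refl
reduced⇒↭ {n} {[]} {_ ∷ _} b∥ red = contradiction (minimal (far-reduced {n} b∥) [] (product-≈ red)) λ ()
reduced⇒↭ {n} {i ∷ a} {b} b∥ red
  with c , b↭ic ← ∈⇒↭∷ (descent⇒∈ {n} b∥ (∷-reduced⇒descent red))
  with _ ∷ c∥ ← far-resp-↭ b↭ic b∥
  = ↭-trans (prep i (reduced⇒↭ c∥ (reduced-resp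
      (λ k → trans (cong (σ i ⟨$⟩ʳ_) (product-↭ {n} b↭ic b∥ k)) (σ-involutive i _))
      (tail-reduced red)))) (↭-sym b↭ic)

allPairs-++⁻ˡ : {A : Set} {R : A → A → Set} (xs : List A) {ys : List A} →
  AllPairs R (xs ++ ys) → AllPairs R xs
allPairs-++⁻ˡ [] _ = []
allPairs-++⁻ˡ (x ∷ xs) (px ∷ pxs) = All.++⁻ˡ xs px ∷ allPairs-++⁻ˡ xs pxs

⊆⇒↭++ : {A : Set} {xs ys : List A} → Unique xs → (∀ {x} → x ∈ₗ xs → x ∈ₗ ys) → ∃[ zs ] ys ↭ xs ++ zs
⊆⇒↭++ {xs = []} {ys} _ _ = ys , refl
⊆⇒↭++ {xs = x ∷ xs} (x∉xs ∷ xs!) xs⊆ys with ys′ , ys↭ ← ∈⇒↭∷ (xs⊆ys (here refl))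
  with zs , ys′↭ ← ⊆⇒↭++ {ys = ys′} xs! (λ y∈xs →
    Any.tail (All.lookup x∉xs y∈xs ∘ sym) (∈-resp-↭ ys↭ (xs⊆ys (there y∈xs))))
  = zs , ↭-trans ys↭ (prep x ys′↭)

-- Rearranging `b` so that it starts with `a` keeps it pairwise far, hence reduced.
far-⊆⇒≤wk : {a b : Word n} → AllPairs Far a → AllPairs Far b → (∀ {i} → i ∈ₗ a → i ∈ₗ b) →
  product {n} a ≤wk product b
far-⊆⇒≤wk {n} {a} {b} a∥ b∥ a⊆b with c , b↭ac ← ⊆⇒↭++ (AllPairs.map proj₁ a∥) a⊆b =
  ≤wk-resp {u = product a} {u′ = product a} {v = product (a ++ c)} {v′ = product b}
    (λ _ → refl) (λ k → sym (product-↭ {n} b↭ac b∥ k))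
    (prefix⇒≤wk a c (far-reduced (far-resp-↭ b↭ac b∥)))

-- Some reduced word of `u` is a prefix of a reduced word of `product b`; the latter rearranges `b`,
-- so the prefix is pairwise far as well.
≤wk-far : {u : Permutation′ n} {b : Word n} → AllPairs Far b → u ≤wk product b →
  ∃[ a ] (AllPairs Far a × product a ≈ u)
≤wk-far {u = u} {b} b∥ u≤b with a , c , a-red , ac-red ← ≤wk⇒prefix {v = u} {product b} u≤b =
  a , allPairs-++⁻ˡ a (far-resp-↭ (↭-sym (reduced⇒↭ b∥ ac-red)) b∥) , product-≈ a-red

-- Boolean intervals

-- Let `u` correspond to the relative complement of `f y` between `f x` and `f z`. If `u` is x, then
-- `f z ⊆ f y`; if `u` is y or z, then `f y ⊆ f x`.
boolean⇒¬three-chain : {A : Set} {_≈₁_ _≤₁_ : Rel A 0ℓ} → Reflexive _≈₁_ → IsBoolean _≈₁_ _≤₁_ →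
  {x y z : A} → x ≤₁ y → y ≤₁ z → ¬ (y ≤₁ x) → ¬ (z ≤₁ y) →
  ¬ (∀ u → x ≤₁ u → u ≤₁ z → u ≈₁ x ⊎ u ≈₁ y ⊎ u ≈₁ z)
boolean⇒¬three-chain ≈-refl (_ , f , iso) {x} {y} {z} x≤y y≤z y≰x z≰y chain =
  case-chain (chain u (cancel (subst (f x ⊆_) (sym fu≡) (Subset.p⊆p∪q _)))
                      (cancel (subst (_⊆ f z) (sym fu≡) complement⊆)))
  where
  open IsOrderIsomorphism iso using (cancel; mono; surjective) renaming (cong to f-cong)
  -- The complement of y in the interval from x to z.
  complement = f x ∪ (f z ∩ ∁ (f y))
  u = proj₁ (surjective complement)
  fu≡ : f u ≡ complement
  fu≡ = proj₂ (surjective complement) ≈-refl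

  complement⊆ : complement ⊆ f z
  complement⊆ e∈ with Subset.x∈p∪q⁻ (f x) _ e∈
  ... | inj₁ e∈x = mono y≤z (mono x≤y e∈x)
  ... | inj₂ e∈  = Subset.p∩q⊆p (f z) _ e∈

  z≤y : complement ⊆ f x → f z ⊆ f y
  z≤y c⊆x {e} e∈z with e Subset.∈? f y
  ... | yes e∈y = e∈y
  ... | no  e∉y = mono x≤y (c⊆x (Subset.q⊆p∪q (f x) _ (Subset.x∈p∩q⁺ (e∈z , Subset.x∉p⇒x∈∁p e∉y))))

  y≤x : f y ⊆ complement → f y ⊆ f x
  y≤x y⊆c e∈y with Subset.x∈p∪q⁻ (f x) _ (y⊆c e∈y)
  ... | inj₁ e∈x = e∈x
  ... | inj₂ e∈  = contradiction e∈y (Subset.x∈∁p⇒x∉p (proj₂ (Subset.x∈p∩q⁻ (f z) _ e∈)))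

  case-chain : ¬ _
  case-chain (inj₁ u≈x)        = z≰y (cancel (z≤y (Subset.⊆-reflexive (trans (sym fu≡) (f-cong u≈x)))))
  case-chain (inj₂ (inj₁ u≈y)) = y≰x (cancel (y≤x (Subset.⊆-reflexive (trans (sym (f-cong u≈y)) fu≡))))
  case-chain (inj₂ (inj₂ u≈z)) = y≰x (cancel (y≤x λ e∈y →
    Subset.⊆-reflexive (trans (sym (f-cong u≈z)) fu≡) (mono y≤z e∈y)))

-- Three-element chains in the weak order

-- Follow the pair `lo k < hi k` through `σ i` and then `σ j`. For k other than i, the first keeps
-- it increasing, and the second reverses it only if it has become `lo j`, `hi j`; undoing `σ i`
-- then gives k = i by adjacency.
adjacent⇒descent-unique : {i j k : Gen n} → Adjacent i j → Descent (product {n} (i ∷ j ∷ [])) k → k ≡ i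
adjacent⇒descent-unique {n} {i} {j} {k} adj (descent d) with k Fin.≟ i
... | yes k≡i = k≡i
... | no k≢i
  with (σ i ⟨$⟩ʳ lo k Fin.≟ lo j) ×-dec (σ i ⟨$⟩ʳ hi k Fin.≟ hi j)
... | no ¬eq = contradiction d (Fin.<-asym (subst₂ _<_ (unfold (lo k)) (unfold (hi k))
        (σ-mono-< j (σ-mono-< i (lo<hi k) (k≢i ∘ lo-injective ∘ proj₁)) ¬eq)))
  where
  unfold : ∀ x → σ {n} j ⟨$⟩ʳ (σ i ⟨$⟩ʳ x) ≡ product {n} (i ∷ j ∷ []) ⟨$⟩ˡ x
  unfold x = sym (trans (σ-inverse j _) (cong (σ j ⟨$⟩ʳ_) (σ-inverse i x)))
... | yes (lo≡ , hi≡) with adj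
...   | inj₁ next = contradiction (lo-injective
        (trans (sym (σ-involutive i _)) (trans (cong (σ i ⟨$⟩ʳ_) lo≡) (σ-pred-lo next)))) k≢i
...   | inj₂ prev = contradiction (hi-injective
        (trans (sym (σ-involutive i _)) (trans (cong (σ i ⟨$⟩ʳ_) hi≡) (σ-suc-hi prev)))) k≢i

++-∷ : {A : Set} (xs : List A) (x : A) (ys : List A) → xs ++ x ∷ ys ≡ (xs ++ [ x ]) ++ ys
++-∷ xs x ys = sym (++-assoc xs [ x ] ys)

-- `u` is the product of `y ++ c`, where `c ++ d` completes `y` to a reduced word of `w` and so has
-- two letters. If `c` is a single letter, cancelling `product y` shows that it is a descent of the
-- product of `i` and `j`, whose only descent is `i`.
two-step-chain : {u w : Permutation′ n} {i j : Gen n} → Adjacent i j → (y : Word n) →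
  Reduced (y ++ i ∷ j ∷ []) w → product y ≤wk u → u ≤wk w →
  u ≈ product y ⊎ u ≈ product (y ++ [ i ]) ⊎ u ≈ w
two-step-chain {n} {u} {w} {i} {j} adj y red y≤u u≤w
  with a , c , a-red , ac-red ← ≤wk⇒prefix {v = product y} {u} y≤u
  with b , d , b-red , bd-red ← ≤wk⇒prefix {v = u} {w} u≤w
  = go c d u≈yc ycd-red (ℕ.+-cancelˡ-≡ (length y) _ _
      (trans (sym (length-++ y)) (trans (reduced-length-≡ ycd-red red) (length-++ y))))
  where
  |y|≡|a| : length y ≡ length a
  |y|≡|a| = reduced-length-≡ (++-reducedˡ y _ red) a-red
  u≈yc : u ≈ product (y ++ c)
  u≈yc k = trans (sym (product-≈ ac-red k)) (trans (product-++ {n} a c k)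
    (trans (product-≈ a-red _) (sym (product-++ {n} y c k))))
  -- `u` comes with two reduced words, `a ++ c` extending a word of `product y` and `b` extending to
  -- one of `w`. The first replaces the second, then `y` replaces `a`.
  ycd-red : Reduced (y ++ (c ++ d)) w
  ycd-red = replace-prefix a (c ++ d) y (product-≈ a-red) |y|≡|a|
    (subst (λ x → Reduced x w) (++-assoc a c d)
      (replace-prefix b d (a ++ c) (λ k → trans (product-≈ b-red k) (sym (product-≈ ac-red k)))
      (reduced-length-≡ ac-red b-red) bd-red))

  go : ∀ c d → u ≈ product (y ++ c) → Reduced (y ++ (c ++ d)) w → length (c ++ d) ≡ 2 →
    u ≈ product y ⊎ u ≈ product (y ++ [ i ]) ⊎ u ≈ w
  go [] d u≈ _ _ = inj₁ λ k → trans (u≈ k) (product-++ {n} y [] k)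
  go c [] u≈ red′ _ = inj₂ (inj₂ λ k → trans (u≈ k)
    (trans (cong (λ x → product (y ++ x) ⟨$⟩ʳ k) (sym (++-identityʳ c))) (product-≈ red′ k)))
  go (k ∷ []) (l ∷ []) u≈ red′ _
    with refl ← adjacent⇒descent-unique {k = k} adj
      (descent-resp {u = product (k ∷ l ∷ [])} {product (i ∷ j ∷ [])} (λ x →
        ⟨$⟩ʳ-injective (product y) (trans (sym (product-++ {n} y (k ∷ l ∷ []) x))
          (trans (product-≈ red′ x) (trans (sym (product-≈ red x)) (product-++ {n} y (i ∷ j ∷ []) x)))))
        (∷-reduced⇒descent (++-reducedʳ y (k ∷ l ∷ []) red′)))
    = inj₂ (inj₁ u≈)
  go (k ∷ []) (l ∷ _ ∷ _) _ _ ()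
  go (k ∷ _ ∷ []) (l ∷ _) _ _ ()
  go (k ∷ _ ∷ _ ∷ _) (l ∷ _) _ _ ()

-- The three prefixes ending around the factor form a chain, strict by length, with nothing else
-- between its ends. A general `P` serves both the ideal of `w` and the intervals above a generator.
boolean⇒¬adjacent-factor : {w : Permutation′ n} {P : Pred (Permutation′ n) 0ℓ} → IsBooleanSubposet P →
  (y : Word n) {i j : Gen n} {r : Word n} → Adjacent i j → Reduced (y ++ i ∷ j ∷ r) w →
  P (product y) → P (product (y ++ [ i ])) → ¬ P (product (y ++ i ∷ j ∷ []))
boolean⇒¬adjacent-factor {n} {w} bool y {i} {j} {r} adj red p₀ p₁ p₂ =
  boolean⇒¬three-chain (λ _ → refl) bool
    {product y , p₀} {product (y ++ [ i ]) , p₁} {product (y ++ i ∷ j ∷ []) , p₂}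
    (prefix⇒≤wk y [ i ] red₁)
    (prefix⇒≤wk (y ++ [ i ]) [ j ] (subst (λ x → Reduced x (product (y ++ i ∷ j ∷ []))) (++-∷ y i [ j ]) red₂))
    (λ y≤x → ℕ.<⇒≱ (longer y [ i ] (s≤s z≤n))
      (≤wk⇒length-≤ {v = product (y ++ [ i ])} {product y} y≤x red₁ (++-reducedˡ y _ red)))
    (λ z≤y → ℕ.<⇒≱ (subst (λ x → length (y ++ [ i ]) ℕ.< length x) (sym (++-∷ y i [ j ]))
        (longer (y ++ [ i ]) [ j ] (s≤s z≤n)))
      (≤wk⇒length-≤ {v = product (y ++ i ∷ j ∷ [])} {product (y ++ [ i ])} z≤y red₂ red₁))
    λ { (u , _) → two-step-chain {u = u} {product (y ++ i ∷ j ∷ [])} adj y red₂ }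
  where
  red₁ : Reduced (y ++ [ i ]) (product (y ++ [ i ]))
  red₁ = ++-reducedˡ (y ++ [ i ]) (j ∷ r) (subst (λ x → Reduced x w) (++-∷ y i (j ∷ r)) red)
  red₂ : Reduced (y ++ i ∷ j ∷ []) (product (y ++ i ∷ j ∷ []))
  red₂ = ++-reducedˡ (y ++ i ∷ j ∷ []) r (subst (λ x → Reduced x w) (sym (++-assoc y (i ∷ j ∷ []) r)) red)
  longer : (a b : Word n) → 0 ℕ.< length b → length a ℕ.< length (a ++ b)
  longer a b 0<b = ℕ.≤-trans (ℕ.m<m+n (length a) 0<b) (ℕ.≤-reflexive (sym (length-++ a)))

-- Induction on the suffix. Its tail is already pairwise far, so a letter of the tail adjacent to
-- `i` can be moved next to `i`, producing a forbidden factor in another reduced word of `w`. A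
-- second `i` in the tail would be a descent of its product, against reducedness.
¬adjacent-factor⇒far : {w : Permutation′ n} →
  (∀ (y : Word n) {i j r} → Adjacent i j → ¬ Reduced (y ++ i ∷ j ∷ r) w) →
  ∀ y x → Reduced (y ++ x) w → AllPairs Far x
¬adjacent-factor⇒far     ¬factor y []      _   = []
¬adjacent-factor⇒far {n} {w} ¬factor y (i ∷ x) red = All.tabulate i∥x ∷ x∥
  where
  x∥ : AllPairs Far x
  x∥ = ¬adjacent-factor⇒far ¬factor (y ++ [ i ]) x (subst (λ z → Reduced z w) (++-∷ y i x) red)
  i∥x : ∀ {j} → j ∈ₗ x → Far i j
  i∥x {j} j∈x with position i j
  ... | far f        = f
  ... | same         = contradiction (inverted (∈⇒descent x∥ j∈x)) (Fin.<-asym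
          (subst₂ _<_ (σ·-hi (product x) i) (σ·-lo (product x) i)
            (inverted (∷-reduced⇒descent (++-reducedʳ y (i ∷ x) red)))))
  ... | adjacent adj with x′ , x↭ ← ∈⇒↭∷ j∈x = contradiction
          (replace-suffix y (i ∷ x) (i ∷ j ∷ x′) (λ k → cong (σ i ⟨$⟩ʳ_) (product-↭ {n} x↭ x∥ k))
            (cong suc (sym (↭-length x↭))) red)
          (¬factor y adj)

far⇒free : {w : Permutation′ n} {a : Word n} → AllPairs Far a → product a ≈ w → Free w
far⇒free {n} {a = a} a∥ a≈w = a , AllPairs.map (far⇒commute {n}) a∥ , a≈w

-- From boolean posets to free permutations

ideal⇒free : {w : Permutation′ n} → HasBooleanIdeal w → Free w
ideal⇒free {n} {w} bool with a , red ← reduced-word w =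
  far⇒free {w = w} {a} (¬adjacent-factor⇒far ¬factor [] a red) (product-≈ red)
  where
  ¬factor : ∀ (y : Word n) {i j r} → Adjacent i j → ¬ Reduced (y ++ i ∷ j ∷ r) w
  ¬factor y {i} {j} {r} adj red = boolean⇒¬adjacent-factor {P = _≤wk w} bool y adj red
    (prefix⇒≤wk y _ red)
    (prefix⇒≤wk (y ++ [ i ]) _ (subst (λ x → Reduced x w) (++-∷ y i (j ∷ r)) red))
    (prefix⇒≤wk (y ++ i ∷ j ∷ []) r (subst (λ x → Reduced x w) (sym (++-assoc y (i ∷ j ∷ []) r)) red))

-- w⁻¹ decreases along `lo i`, `hi i` = `lo j`, `hi j`. Multiplying on the left by `σ i`, `σ j`,
-- `σ i` sorts these three entries, each time at a descent, so the three letters can be prepended to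
-- a reduced word of the rest.
braid : {w : Permutation′ n} {i j : Gen n} → toℕ j ≡ suc (toℕ i) → Descent w i → Descent w j →
  ∃[ r ] Reduced (i ∷ j ∷ i ∷ r) w
braid {n} {w} {i} {j} next d-i@(descent di) (descent dj)
  with r , red ← reduced-word (σ i · σ j · σ i · w)
  = r , ∷-reduced d-i (∷-reduced d₁ (∷-reduced d₂ red))
  where
  hj<hi : w ⟨$⟩ˡ hi j < w ⟨$⟩ˡ hi i
  hj<hi = subst (λ x → w ⟨$⟩ˡ hi j < w ⟨$⟩ˡ x) (sym (hi≡lo next)) dj
  d₁ : Descent (σ i · w) j
  d₁ = descent (subst₂ _<_ (sym (σ·-⟨$⟩ˡ w (σ-pred-hi next))) (sym (σ·-⟨$⟩ˡ w (σ-pred-lo next)))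
    (Fin.<-trans hj<hi di))
  d₂ : Descent (σ j · σ i · w) i
  d₂ = descent (subst₂ _<_
    (sym (trans (σ·-⟨$⟩ˡ (σ i · w) (σ-suc-hi next)) (σ·-⟨$⟩ˡ w (σ-pred-hi next))))
    (sym (trans (σ·-⟨$⟩ˡ (σ i · w) (σ-suc-lo next)) (σ·-⟨$⟩ˡ w (σ-lo i)))) hj<hi)

intervals⇒free : {w : Permutation′ n} → (∀ i → Support w i → IsBooleanInterval (σ i) w) → Free w
intervals⇒free {n} {w} intervals with a , red ← reduced-word w =
  far⇒free {w = w} {a} (¬adjacent-factor⇒far ¬factor [] a red) (product-≈ red)
  where
  ¬consecutive : ∀ {i j} → Support w i → Support w j → toℕ j ≢ suc (toℕ i)
  -- The boolean intervals place both generators below `w`, so `braid` applies. The forbidden factor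
  -- is the `j i` that follows the first letter of `i j i`, which keeps the whole chain above `σ i`.
  ¬consecutive {i} {j} i∈T j∈T next =
    boolean⇒¬adjacent-factor {w = w} {P = [ σ i , w ]wk} (proj₂ (intervals i i∈T))
      [ i ] (inj₂ next) iji-red
      (above [] iji-red) (above [ j ] iji-red) (above (j ∷ i ∷ []) iji-red)
    where
    iji-red : Reduced (i ∷ j ∷ i ∷ _) w
    iji-red = proj₂ (braid next (σ≤wk⇒descent {w = w} (proj₁ (intervals i i∈T)))
                            (σ≤wk⇒descent {w = w} (proj₁ (intervals j j∈T))))
    above : ∀ b {c} → Reduced ((i ∷ b) ++ c) w → [ σ i , w ]wk (product (i ∷ b))
    above b {c} red =
      descent⇒σ≤wk (∷-reduced⇒descent (++-reducedˡ (i ∷ b) c red)) , prefix⇒≤wk (i ∷ b) c red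

  ¬factor : ∀ (y : Word n) {i j r} → Adjacent i j → ¬ Reduced (y ++ i ∷ j ∷ r) w
  ¬factor y {i} {j} adj red with adj
  ... | inj₁ next = ¬consecutive i∈T j∈T next
    where
    i∈T = _ , fromReduced red , ∈-++⁺ʳ y (here refl)
    j∈T = _ , fromReduced red , ∈-++⁺ʳ y (there (here refl))
  ... | inj₂ prev = ¬consecutive j∈T i∈T prev
    where
    i∈T = _ , fromReduced red , ∈-++⁺ʳ y (here refl)
    j∈T = _ , fromReduced red , ∈-++⁺ʳ y (there (here refl))

-- Intervals below a free permutation

open module FinMembership {m} = DecMembership (Fin._≟_ {m}) using () renaming (_∈?_ to _∈ₗ?_)

-- A letter that recurs later cancels against its copy, as generators are involutions. Keeping the
-- letters of `b` among those of `a` lets `b` inherit commutation with the head, which excludes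
-- adjacency.
commuting⇒far : (a : Word n) → AllPairs (λ i j → σ {n} i · σ j ≈ σ j · σ i) a →
  ∃[ b ] (AllPairs Far b × (∀ {i} → i ∈ₗ b → i ∈ₗ a) × product {n} b ≈ product a)
commuting⇒far [] _ = [] , [] , (λ ()) , λ _ → refl
commuting⇒far {n} (i ∷ a) (i-comm ∷ a-comm)
  with b , b∥ , b⊆a , b≈a ← commuting⇒far {n} a a-comm
  with i ∈ₗ? b
... | yes i∈b with c , b↭ic ← ∈⇒↭∷ i∈b with _ ∷ c∥ ← far-resp-↭ b↭ic b∥
  = c , c∥ , (λ j∈c → there (b⊆a (∈-resp-↭ (↭-sym b↭ic) (there j∈c)))) ,
    λ k → trans (sym (σ-involutive i _))
      (cong (σ i ⟨$⟩ʳ_) (trans (sym (product-↭ {n} b↭ic b∥ k)) (b≈a k)))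
... | no i∉b = i ∷ b , All.tabulate i∥b ∷ b∥ ,
    (λ { (here eq) → here eq ; (there j∈b) → there (b⊆a j∈b) }) ,
    λ k → cong (σ i ⟨$⟩ʳ_) (b≈a k)
  where
  i∥b : ∀ {j} → j ∈ₗ b → Far i j
  i∥b {j} j∈b with position i j
  ... | same         = contradiction j∈b i∉b
  ... | adjacent adj = contradiction (All.lookup i-comm (b⊆a j∈b)) (adjacent⇒¬commute {n} adj)
  ... | far f        = f

free⇒far : {w : Permutation′ n} → Free w → ∃[ b ] (AllPairs Far b × product b ≈ w)
free⇒far {n} (a , comm , a≈w) with b , b∥ , _ , b≈a ← commuting⇒far {n} a comm =
  b , b∥ , λ k → trans (b≈a k) (a≈w k)

-- A nonempty suffix extending a reduced word of `u` to one of `v` would make `v` strictly longer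
-- than `u`.
≤wk-antisym : {u v : Permutation′ n} → u ≤wk v → v ≤wk u → u ≈ v
≤wk-antisym {u = u} {v} u≤v v≤u with a , b , a-red , ab-red ← ≤wk⇒prefix {v = u} {v} u≤v = go b ab-red
  where
  go : ∀ b → Reduced (a ++ b) v → u ≈ v
  go []      red k = trans (sym (product-≈ a-red k))
    (trans (cong (λ x → product x ⟨$⟩ʳ k) (sym (++-identityʳ a))) (product-≈ red k))
  go (i ∷ b) red = contradiction (≤wk⇒length-≤ {v = v} {u} v≤u red a-red)
    (ℕ.<⇒≱ (ℕ.≤-trans (ℕ.m<m+n (length a) (s≤s z≤n)) (ℕ.≤-reflexive (sym (length-++ a)))))

lookup-injective : {A : Set} {xs : List A} → Unique xs → ∀ {i j} → lookup xs i ≡ lookup xs j → i ≡ j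
lookup-injective (_ ∷ _)      {zero}  {zero}  _  = refl
lookup-injective (x∉xs ∷ _)   {zero}  {suc j} eq = contradiction eq (All.lookup x∉xs (∈-lookup j))
lookup-injective (x∉xs ∷ _)   {suc i} {zero}  eq = contradiction (sym eq) (All.lookup x∉xs (∈-lookup i))
lookup-injective (_ ∷ xs!)    {suc i} {suc j} eq = cong suc (lookup-injective xs! eq)

allPairs-++⁻ʳ : {A : Set} {R : Rel A 0ℓ} (xs : List A) {ys : List A} →
  AllPairs R (xs ++ ys) → AllPairs R ys
allPairs-++⁻ʳ []       pys       = pys
allPairs-++⁻ʳ (_ ∷ xs) (_ ∷ pxs) = allPairs-++⁻ʳ xs pxs

allPairs-++⁻ : {A : Set} {R : Rel A 0ℓ} (xs : List A) {ys : List A} → AllPairs R (xs ++ ys) →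
  ∀ {x y} → x ∈ₗ xs → y ∈ₗ ys → R x y
allPairs-++⁻ (_ ∷ xs) (px ∷ _)  (here refl) y∈ys = All.lookup px (∈-++⁺ʳ xs y∈ys)
allPairs-++⁻ (_ ∷ xs) (_ ∷ pxs) (there x∈)  y∈ys = allPairs-++⁻ xs pxs x∈ y∈ys

-- The intervals [ id , w ] and [ σ i , w ] are the cases c = [] and c = [ i ].  An element of the
-- interval is determined by its descents, which contain c and may be any subset of a otherwise.
module _ {w : Permutation′ n} (c a : Word n) (ca∥ : AllPairs Far (c ++ a)) (ca≈w : product (c ++ a) ≈ w)
         {P : Pred (Permutation′ n) 0ℓ} (P⇔ : ∀ u → P u ⇔ (u ≤wk w × All (Descent u) c)) where

  private
    module P u = Equivalence (P⇔ u)

    descents : ∃ P → Subset (length a)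
    descents (u , _) = tabulate λ j → does (descent? u (lookup a j))

    lookup-descents : ∀ x j → Vec.lookup (descents x) j ≡ does (descent? (proj₁ x) (lookup a j))
    lookup-descents (u , _) = lookup∘tabulate λ j → does (descent? u (lookup a j))

    ∈-descents⁺ : ∀ {x j} → Descent (proj₁ x) (lookup a j) → j Subset.∈ descents x
    ∈-descents⁺ {x} {j} d =
      lookup⇒[]= j (descents x) (trans (lookup-descents x j) (dec-true (descent? _ _) d))

    ∈-descents⁻ : ∀ {x j} → j Subset.∈ descents x → Descent (proj₁ x) (lookup a j)
    ∈-descents⁻ {x} {j} j∈ = invert (subst (Reflects (Descent (proj₁ x) (lookup a j)))
      (trans (sym (lookup-descents x j)) ([]=⇒lookup j∈)) (proof (descent? (proj₁ x) (lookup a j))))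

    ≤wk⇒far : ∀ {u} → u ≤wk w → ∃[ b ] (AllPairs Far b × product b ≈ u)
    ≤wk⇒far {u} u≤w = ≤wk-far {u = u} ca∥
      (≤wk-resp {u = u} {u} {w} {product (c ++ a)} (λ _ → refl) (sym ∘ ca≈w) u≤w)

    descent⇒∈-support : ∀ {u i} → u ≤wk w → Descent u i → i ∈ₗ c ++ a
    descent⇒∈-support {u} u≤w d = descent⇒∈ ca∥
      (descent-resp {v = product (c ++ a)} (sym ∘ ca≈w) (descent-mono {u = u} {w} u≤w d))

    -- Both elements are products of pairwise far words whose letters are their descents, so
    -- inclusion of descents suffices. Descents outside `a` lie in `c` and are common to all of `P`.
    cancel : ∀ {x y} → descents x ⊆ descents y → proj₁ x ≤wk proj₁ y
    cancel {u , p} {v , q} ⊆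
      with x , x∥ , x≈u ← ≤wk⇒far {u} (proj₁ (P.to u p))
         | y , y∥ , y≈v ← ≤wk⇒far {v} (proj₁ (P.to v q))
      = ≤wk-resp {u = product x} {u} {product y} {v} x≈u y≈v (far-⊆⇒≤wk x∥ y∥ λ i∈x →
          descent⇒∈ y∥ (descent-resp {v = product y} (sym ∘ y≈v)
            (sub (descent-resp {v = u} x≈u (∈⇒descent x∥ i∈x)))))
      where
      sub : ∀ {i} → Descent u i → Descent v i
      sub {i} d with ∈-++⁻ c (descent⇒∈-support {u} (proj₁ (P.to u p)) d)
      ... | inj₁ i∈c = All.lookup (proj₂ (P.to v q)) i∈c
      ... | inj₂ i∈a = subst (Descent v) (sym (lookup-index i∈a))
              (∈-descents⁻ {v , q} (⊆ (∈-descents⁺ {u , p} (subst (Descent u) (lookup-index i∈a) d))))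

    mono : ∀ {x y} → proj₁ x ≤wk proj₁ y → descents x ⊆ descents y
    mono {x@(u , _)} {y@(v , _)} u≤v j∈ =
      ∈-descents⁺ {y} (descent-mono {u = u} {v} u≤v (∈-descents⁻ {x} j∈))

    descents-cong : ∀ {x y} → proj₁ x ≈ proj₁ y → descents x ≡ descents y
    descents-cong {x} {y} x≈y = Subset.⊆-antisym
      (λ j∈ → ∈-descents⁺ {y} (descent-resp x≈y (∈-descents⁻ {x} j∈)))
      (λ j∈ → ∈-descents⁺ {x} (descent-resp (sym ∘ x≈y) (∈-descents⁻ {y} j∈)))

    injective : ∀ {x y} → descents x ≡ descents y → proj₁ x ≈ proj₁ y
    injective {x} {y} eq = ≤wk-antisym {u = proj₁ x} {proj₁ y}
      (cancel {x} {y} (Subset.⊆-reflexive eq)) (cancel {y} {x} (Subset.⊆-reflexive (sym eq)))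

    module _ (R : Subset (length a)) where

      Selected : Gen n → Set
      Selected i = i ∈ₗ c ⊎ ∃[ j ] (j Subset.∈ R × lookup a j ≡ i)

      selected? : ∀ i → Dec (Selected i)
      selected? i = (i ∈ₗ? c) ⊎-dec Fin.any? λ j → (j Subset.∈? R) ×-dec (lookup a j Fin.≟ i)

      -- Filtering `c ++ a` makes the word inherit pairwise farness and containment in `c ++ a`.
      selection : Word n
      selection = filter selected? (c ++ a)

      selection∥ : AllPairs Far selection
      selection∥ = AllPairs.filter⁺ selected? ca∥

      selection∈P : P (product selection)
      selection∈P = P.from (product selection)
        ( ≤wk-resp {u = product selection} {product selection} {product (c ++ a)} {w} (λ _ → refl) ca≈w
            (far-⊆⇒≤wk selection∥ ca∥ (proj₁ ∘ ∈-filter⁻ selected?))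
        , All.tabulate λ i∈c → ∈⇒descent selection∥ (∈-filter⁺ selected? (∈-++⁺ˡ i∈c) (inj₁ i∈c)))

      -- The letters of `c ++ a` are distinct, so a letter of `a` is not in `c` and determines its
      -- position.
      selected⁻ : ∀ {j} → Selected (lookup a j) → j Subset.∈ R
      selected⁻ {j} (inj₁ i∈c) = contradiction refl (proj₁ (allPairs-++⁻ c ca∥ i∈c (∈-lookup j)))
      selected⁻ (inj₂ (k , k∈R , eq)) = subst (Subset._∈ R)
        (lookup-injective (AllPairs.map proj₁ (allPairs-++⁻ʳ c ca∥)) eq) k∈R

      descents-selection : descents (product selection , selection∈P) ≡ R
      descents-selection = Subset.⊆-antisym
        (λ j∈ → selected⁻ (proj₂ (∈-filter⁻ selected? {xs = c ++ a} (descent⇒∈ selection∥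
          (∈-descents⁻ {product selection , selection∈P} j∈)))))
        (λ {j} j∈R → ∈-descents⁺ {product selection , selection∈P} (∈⇒descent selection∥
          (∈-filter⁺ selected? (∈-++⁺ʳ c (∈-lookup j)) (inj₂ (j , j∈R , refl)))))

  far⇒boolean : IsBooleanSubposet P
  far⇒boolean = length a , descents , record
    { isOrderMonomorphism = record
      { isOrderHomomorphism = record
        { cong = λ {x} {y} → descents-cong {x} {y}
        ; mono = λ {x} {y} → mono {x} {y}
        }
      ; injective = λ {x} {y} → injective {x} {y}
      ; cancel    = λ {x} {y} → cancel {x} {y}
      }
    ; surjective = λ R → (product (selection R) , selection∈P R) ,
        λ {z} z≈ → trans (descents-cong {z} {product (selection R) , selection∈P R} z≈)
          (descents-selection R)
    }

free⇒ideal : {w : Permutation′ n} → Free w → HasBooleanIdeal w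
free⇒ideal {w = w} free with b , b∥ , b≈w ← free⇒far {w = w} free =
  far⇒boolean {w = w} [] b b∥ b≈w {P = _≤wk w} λ u → mk⇔ (_, []) proj₁

free⇒intervals : {w : Permutation′ n} → Free w → ∀ i → Support w i → IsBooleanInterval (σ i) w
free⇒intervals {n} {w} free i (a , red , i∈a)
  with b , b∥ , b≈w ← free⇒far {w = w} free
  -- The reduced word of `w` containing `i` rearranges `b`, so `i` occurs in `b` and can be moved to
  -- its front.
  with c , b↭ic ← ∈⇒↭∷ (∈-resp-↭ (reduced⇒↭ b∥
         (reduced-resp (sym ∘ b≈w) (toReduced {a = a} {w = w} red))) i∈a)
  = descent⇒σ≤wk {w = w} (descent-resp {u = product (i ∷ c)} {w} ic≈w (∈⇒descent ic∥ (here refl))) ,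
    far⇒boolean {w = w} [ i ] c ic∥ ic≈w {P = [ σ i , w ]wk} λ u → mk⇔
      (λ { (σ≤u , u≤w) → u≤w , σ≤wk⇒descent {w = u} σ≤u ∷ [] })
      (λ { (u≤w , d ∷ []) → descent⇒σ≤wk {w = u} d , u≤w })
  where
  ic∥ : AllPairs Far (i ∷ c)
  ic∥ = far-resp-↭ b↭ic b∥
  ic≈w : product (i ∷ c) ≈ w
  ic≈w k = trans (sym (product-↭ {n} b↭ic b∥ k)) (b≈w k)

corollary6p5 : (n : ℕ) (w : Permutation′ n) →
    ((∀ i → i ∈ Support w → IsBooleanInterval (σ i) w) ⇔ Free w)
    × ((∀ i → i ∈ Support w → IsBooleanInterval (σ i) w) ⇔ HasBooleanIdeal w)
corollary6p5 n w =
    mk⇔ (intervals⇒free {w = w}) (free⇒intervals {w = w})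
  , mk⇔ (free⇒ideal {w = w} ∘ intervals⇒free {w = w}) (free⇒intervals {w = w} ∘ ideal⇒free {w = w})
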